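{- Let $R$ be the canonical translation of 3XOR instances to 3CNFs (each XOR clause replaced by its canonical block of four 3-clauses, no auxiliary variables), restricted to the balanced slice of 3XOR instances with fixed $n$ and $m$. Then $R$ is injective (every fiber over the image window $\mathcal W$ has size $1$). Hence the push-forward under $R$ of the uniform distribution on the domain is exactly the uniform distribution on the image window $\mathcal W$ (that is, the total variation distance $\delta$ between them is $0$).
   Context: A 3XOR instance $\Phi(A,b)$ on $n$ variables is an ordered list of $m=(1+\gamma)n$ XOR clauses ($\gamma\in(0,1]$ fixed), given by a linear system $Ax=b$ over $\mathbb F_2$ in which each row of $A\in\{0,1\}^{m\times n}$ has Hamming weight three; the $i$-th clause is the equation $x_{j_1}\oplus x_{j_2}\oplus x_{j_3}=b_i$ on three distinct variables. The balanced slice is the set of such instances for fixed $n,m$. The canonical translation $R$ replaces each XOR clause, in order, by the block of the four 3-clauses on the same three variables whose conjunction is equivalent to that XOR clause (one clause excluding each of the four violating assignments), with a fixed literal order within clauses and a fixed order within the block, introducing no auxiliary variables; so the resulting 3CNF has the same variables and $m'=4m$ clauses. The image window $\mathcal W$ is the class of 3CNFs obtained in this way, i.e. by replacing each XOR clause by its canonical block of four 3-clauses. The fiber of $\Psi\in\mathcal W$ is $R^{ -1}(\Psi)$. -}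

module Defs where

open import Data.Bool using (Bool; true; false; not; _xor_; if_then_else_)
import Data.Bool.Properties as Bool
open import Data.Empty using (⊥-elim)
open import Data.Fin using (Fin; zero; suc)
import Data.Fin.Properties as Fin
open import Data.Fin.Permutation using (Permutation′; _⟨$⟩ʳ_)
open import Data.Fin.Subset using (Subset; inside; outside; ∣_∣)
open import Data.Integer using (+_)
open import Data.List as List using (List; []; _∷_; length; filter; cartesianProduct; cartesianProductWith)
open import Data.List.Membership.Propositional using (_∈_; lose)
open import Data.List.Membership.Propositional.Properties
  using (∈-allFin; ∈-filter⁺; ∈-length; ∈-cartesianProduct⁺; ∈-cartesianProductWith⁺)
open import Data.List.Relation.Unary.All using (All; []; _∷_)
open import Data.List.Relation.Unary.AllPairs using ([]; _∷_)
open import Data.List.Relation.Unary.Any using (here; there; any?; satisfied)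
open import Data.List.Relation.Unary.Unique.Propositional using (Unique)
import Data.List.Relation.Unary.Unique.Propositional.Properties as Unique
open import Data.Nat as ℕ using (ℕ; zero; suc; NonZero; >-nonZero)
import Data.Nat.Properties as ℕ
open import Data.Product using (Σ; ∃; _×_; _,_; proj₁)
open import Data.Product.Properties using (≡-dec)
open import Data.Rational as ℚ using (ℚ; 0ℚ; ½)
open import Data.Vec as Vec using (Vec; []; _∷_; lookup; tabulate; zipWith; concat; fromList)
import Data.Vec.Properties as Vec
open import Relation.Binary using (DecidableEquality)
open import Relation.Binary.PropositionalEquality using (_≡_; _≢_; refl; cong; subst)
open import Relation.Nullary using (yes; no; does; ¬?; Irrelevant)
open import Relation.Nullary.Decidable using (map′)
open import Relation.Unary using (Decidable)

record Finite (A : Set) : Set where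
  infix 4 _≟_
  field
    _≟_      : DecidableEquality A
    elements : List A
    complete : ∀ x → x ∈ elements
    unique   : Unique elements

open Finite ⦃ ... ⦄ public

module _ {A : Set} {P : A → Set} (P? : Decidable P) (P-irr : ∀ {x} → Irrelevant (P x)) where

  restrict : List A → List (Σ A P)
  restrict []       = []
  restrict (x ∷ xs) with P? x
  ... | yes p = (x , p) ∷ restrict xs
  ... | no  _ = restrict xs

  restrict-complete : ∀ {x xs} (p : P x) → x ∈ xs → (x , p) ∈ restrict xs
  restrict-complete {x} p (here {x = y} refl) with P? x
  ... | yes q = here (cong (x ,_) (P-irr p q))
  ... | no ¬p = ⊥-elim (¬p p)
  restrict-complete p (there {x = y} i) with P? y
  ... | yes _ = there (restrict-complete p i)
  ... | no  _ = restrict-complete p i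

  restrict-fresh : ∀ {x xs} (p : P x) → All (x ≢_) xs → All ((x , p) ≢_) (restrict xs)
  restrict-fresh p [] = []
  restrict-fresh p (_∷_ {x = y} x≢y x∉) with P? y
  ... | yes _ = (λ e → x≢y (cong proj₁ e)) ∷ restrict-fresh p x∉
  ... | no  _ = restrict-fresh p x∉

  restrict-unique : ∀ {xs} → Unique xs → Unique (restrict xs)
  restrict-unique [] = []
  restrict-unique (_∷_ {x = x} x∉ u) with P? x
  ... | yes p = restrict-fresh p x∉ ∷ restrict-unique u
  ... | no  _ = restrict-unique u

  finite-Σ : ⦃ Finite A ⦄ → Finite (Σ A P)
  finite-Σ = record
    { _≟_      = ≡-dec _≟_ (λ p q → yes (P-irr p q))
    ; elements = restrict elements
    ; complete = λ (x , p) → restrict-complete p (complete x)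
    ; unique   = restrict-unique unique
    }

instance
  finite-Bool : Finite Bool
  finite-Bool = record
    { _≟_      = Bool._≟_
    ; elements = false ∷ true ∷ []
    ; complete = λ { false → here refl ; true → there (here refl) }
    ; unique   = ((λ ()) ∷ []) ∷ [] ∷ []
    }

  finite-Fin : ∀ {n} → Finite (Fin n)
  finite-Fin = record
    { _≟_      = Fin._≟_
    ; elements = List.allFin _
    ; complete = ∈-allFin
    ; unique   = Unique.allFin⁺ _
    }

  finite-× : ∀ {A B} → ⦃ Finite A ⦄ → ⦃ Finite B ⦄ → Finite (A × B)
  finite-× = record
    { _≟_      = ≡-dec _≟_ _≟_
    ; elements = cartesianProduct elements elements
    ; complete = λ (x , y) → ∈-cartesianProduct⁺ (complete x) (complete y)
    ; unique   = Unique.cartesianProduct⁺ unique unique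
    }

module _ {A : Set} ⦃ _ : Finite A ⦄ where

  vectors : ∀ k → List (Vec A k)
  vectors zero    = [] ∷ []
  vectors (suc k) = cartesianProductWith _∷_ elements (vectors k)

  vectors-complete : ∀ {k} (xs : Vec A k) → xs ∈ vectors k
  vectors-complete []       = here refl
  vectors-complete (x ∷ xs) = ∈-cartesianProductWith⁺ _∷_ (complete x) (vectors-complete xs)

  vectors-unique : ∀ k → Unique (vectors k)
  vectors-unique zero    = [] ∷ []
  vectors-unique (suc k) =
    Unique.cartesianProductWith⁺ _∷_ Vec.∷-injective unique (vectors-unique k)

  instance
    finite-Vec : ∀ {k} → Finite (Vec A k)
    finite-Vec = record
      { _≟_      = Vec.≡-dec _≟_
      ; elements = vectors _
      ; complete = vectors-complete
      ; unique   = vectors-unique _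
      }

-- 𝔽₂ is Bool with _xor_ as addition.

-- A row of the coefficient matrix of the system.
Row : ℕ → Set
Row n = ∃ λ (a : Subset n) → ∣ a ∣ ≡ 3

instance
  finite-Row : ∀ {n} → Finite (Row n)
  finite-Row = finite-Σ (λ a → ∣ a ∣ ℕ.≟ 3) ℕ.≡-irrelevant

-- A row together with the corresponding entry of the right-hand side.
XORClause : ℕ → Set
XORClause n = Row n × Bool

XORInstance : ℕ → ℕ → Set
XORInstance n m = Vec (XORClause n) m

-- (v , s) is the literal satisfied exactly when variable v takes the value s.
Literal : ℕ → Set
Literal n = Fin n × Bool

Clause : ℕ → Set
Clause n = Vec (Literal n) 3

CNF : ℕ → ℕ → Set
CNF n k = Vec (Clause n) k

-- The members of a subset in increasing order.
members : ∀ {n} (a : Subset n) → Vec (Fin n) ∣ a ∣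
members []            = []
members (inside  ∷ a) = zero ∷ Vec.map suc (members a)
members (outside ∷ a) = Vec.map suc (members a)

variables : ∀ {n} → XORClause n → Vec (Fin n) 3
variables ((a , w) , _) = subst (Vec (Fin _)) w (members a)

parity : ∀ {k} → Vec Bool k → Bool
parity = Vec.foldr′ _xor_ false

violations : Bool → List (Vec Bool 3)
violations b = filter (λ α → ¬? (parity α ≟ b)) elements

-- The case split only lets the length of the list compute to 4.
violating : Bool → Vec (Vec Bool 3) 4
violating false = fromList (violations false)
violating true  = fromList (violations true)

-- The clause whose only falsifying assignment to the variables vs is α.
excluding : ∀ {n} → Vec (Fin n) 3 → Vec Bool 3 → Clause n
excluding = zipWith (λ v αᵥ → v , not αᵥ)

permute : ∀ {A : Set} {k} → Permutation′ k → Vec A k → Vec A k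
permute π xs = tabulate (λ i → lookup xs (π ⟨$⟩ʳ i))

-- A fixed choice of the order of the literals in each clause and of the
-- clauses in each block, relative to increasing variables and lexicographically
-- ordered violating assignments.  The choice may depend on the XOR clause (and,
-- for literals, on the excluded assignment), so that every ordering rule is covered.
record Convention (n : ℕ) : Set where
  field
    literalOrder : XORClause n → Vec Bool 3 → Permutation′ 3
    clauseOrder  : XORClause n → Permutation′ 4

module _ {n : ℕ} (conv : Convention n) where
  open Convention conv

  block : XORClause n → Vec (Clause n) 4
  block c@(_ , b) = permute (clauseOrder c)
    (Vec.map (λ α → permute (literalOrder c α) (excluding (variables c) α)) (violating b))

  module _ (m : ℕ) where

    R : XORInstance n m → CNF n (m ℕ.* 4)
    R Φ = concat (Vec.map block Φ)

    Fiber : CNF n (m ℕ.* 4) → XORInstance n m → Set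
    Fiber Ψ Φ = R Φ ≡ Ψ

    fiber? : ∀ Ψ → Decidable (Fiber Ψ)
    fiber? Ψ Φ = R Φ ≟ Ψ

    Window : CNF n (m ℕ.* 4) → Set
    Window Ψ = ∃ (Fiber Ψ)

    window? : Decidable Window
    window? Ψ = map′ satisfied (λ (Φ , e) → lose (complete Φ) e) (any? (fiber? Ψ) elements)

module _ {A : Set} ⦃ _ : Finite A ⦄ where

  card : ∀ {P : A → Set} → Decidable P → ℕ
  card P? = length (filter P? elements)

  card-nonZero : ∀ {P : A → Set} (P? : Decidable P) → ∃ P → NonZero (card P?)
  card-nonZero P? (x , p) = >-nonZero (∈-length (∈-filter⁺ P? (complete x) p))

  ∑ : (A → ℚ) → ℚ
  ∑ f = List.foldr ℚ._+_ 0ℚ (List.map f elements)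

Mass : Set → Set
Mass A = A → ℚ

module _ {A : Set} ⦃ _ : Finite A ⦄ where

  -- The element of P only certifies that 1 / card P? is defined.
  uniformOn : ∀ {P : A → Set} → Decidable P → ∃ P → Mass A
  uniformOn P? w x = if does (P? x) then (+ 1 ℚ./ card P?) ⦃ card-nonZero P? w ⦄ else 0ℚ

  pushforward : ∀ {B : Set} ⦃ _ : Finite B ⦄ → (A → B) → Mass A → Mass B
  pushforward f μ y = ∑ (λ x → if does (f x ≟ y) then μ x else 0ℚ)

  δ : Mass A → Mass A → ℚ
  δ μ ν = ½ ℚ.* ∑ (λ x → ℚ.∣ μ x ℚ.- ν x ∣)

{-# OPTIONS --safe #-}

-- Whatever the ordering conventions, each clause in the block of an XOR clause with
-- right-hand side b determines that XOR clause: its variables are those of the row,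
-- and the parity of its signs (the negations of three values of parity ≠ b) is b.
-- All blocks have four clauses, so R is injective; hence exactly one instance lies
-- over each point of the window, and the window has as many points as the domain.
module Submission where

open import Defs
open import Algebra.Bundles using (CommutativeRing)
open import Data.Bool using (Bool; true; false; not; _xor_; if_then_else_)
open import Data.Bool.Properties using (xor-∧-commutativeRing)
open import Data.Fin using (Fin; zero; suc)
open import Data.Fin.Permutation using (Permutation′; _⟨$⟩ʳ_; _⟨$⟩ˡ_; inverseʳ)
import Data.Fin.Subset as Subset
open import Data.Fin.Subset using (Subset; inside; outside)
open import Data.Fin.Subset.Properties using (⊆-antisym)
open import Data.Integer using (+_)
open import Data.List as List using (List; []; _∷_; length; filter)
open import Data.List.Membership.Propositional using (_∈_)
open import Data.List.Membership.Propositional.Properties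
  using (∈-filter⁺; ∈-filter⁻; ∈-map⁺; ∈-map⁻)
open import Data.List.Membership.Propositional.Properties.WithK using (unique∧set⇒bag)
open import Data.List.Properties using (length-map; filter-none)
open import Data.List.Relation.Binary.BagAndSetEquality using (_∼[_]_; set; ∼bag⇒↭)
open import Data.List.Relation.Binary.Permutation.Propositional.Properties using (↭-length)
import Data.List.Relation.Unary.All as All
open import Data.List.Relation.Unary.AllPairs using ([]; _∷_)
open import Data.List.Relation.Unary.Any using (here)
open import Data.List.Relation.Unary.Unique.Propositional using (Unique)
import Data.List.Relation.Unary.Unique.Propositional.Properties as Unique
open import Data.Nat using (ℕ; zero; suc; NonZero)
import Data.Nat.Properties as ℕ
open import Data.Product using (∃; _×_; _,_; proj₁; proj₂)
open import Data.Rational using (ℚ; 0ℚ; 1ℚ; ½; _<_; _≤_; _+_; _-_; _*_; _/_; ∣_∣; +-0-rawMonoid)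
import Data.Rational.Properties as ℚ
open import Data.Unit using (tt)
open import Data.Vec as Vec using (Vec; []; _∷_; lookup)
open import Data.Vec.Functional using (Vector)
open import Data.Vec.Membership.Propositional using (find) renaming (_∈_ to _∈ᵥ_)
import Data.Vec.Membership.Propositional.Properties as ∈ᵥ
open import Data.Vec.Properties
  using (++-injective; lookup-map; lookup∘tabulate; tabulate-∘; tabulate-cong)
import Data.Vec.Relation.Unary.All as VecAll
import Data.Vec.Relation.Unary.All.Properties as VecAll
import Data.Vec.Relation.Unary.Any as VecAny
import Data.Vec.Relation.Unary.Any.Properties as VecAny
open import Function using (_∘_; _⇔_; mk⇔; Equivalence)
open import Function.Construct.Composition using (_⇔-∘_)
open import Function.Definitions using (Injective)
open import Relation.Binary.PropositionalEquality
  using (_≡_; refl; sym; trans; cong; cong₂; subst; module ≡-Reasoning)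
open import Relation.Nullary using (¬_; yes; no; does)
open import Relation.Unary using (Decidable)
open import Relation.Unary.Properties using (U?)

open import Algebra.Properties.CommutativeMonoid.Sum
  (CommutativeRing.+-commutativeMonoid xor-∧-commutativeRing)
  using (sum; sum-permute)
open import Algebra.Definitions.RawMonoid +-0-rawMonoid
  using () renaming (_×_ to _×ℚ_)

open Equivalence using (to; from)

-- Effect of permuting a vector on membership, maps and parity.

module _ {A : Set} {k : ℕ} (π : Permutation′ k) where

  ∈-permute : ∀ {x} (xs : Vec A k) → x ∈ᵥ permute π xs ⇔ x ∈ᵥ xs
  ∈-permute {x} xs = mk⇔ fwd bwd
    where
    fwd : x ∈ᵥ permute π xs → x ∈ᵥ xs
    fwd p with i , refl ← VecAny.tabulate⁻ p = ∈ᵥ.∈-lookup (π ⟨$⟩ʳ i) xs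

    bwd : x ∈ᵥ xs → x ∈ᵥ permute π xs
    -- The entry at index `i` of `xs` reappears in `permute π xs` at the preimage of `i` under `π`.
    bwd p = subst (_∈ᵥ permute π xs)
      (trans (cong (lookup xs) (inverseʳ π)) (sym (VecAny.lookup-index p)))
      (∈ᵥ.∈-tabulate⁺ (λ i → lookup xs (π ⟨$⟩ʳ i)) (π ⟨$⟩ˡ VecAny.index p))

  map-permute : ∀ {B : Set} (f : A → B) (xs : Vec A k) →
    Vec.map f (permute π xs) ≡ permute π (Vec.map f xs)
  map-permute f xs = trans (sym (tabulate-∘ f _))
    (tabulate-cong (λ i → sym (lookup-map (π ⟨$⟩ʳ i) f xs)))

parity-tabulate : ∀ {k} (f : Vector Bool k) → parity (Vec.tabulate f) ≡ sum f
parity-tabulate {zero}  f = refl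
parity-tabulate {suc k} f = cong (f zero xor_) (parity-tabulate (f ∘ suc))

sum-lookup : ∀ {k} (xs : Vec Bool k) → sum (lookup xs) ≡ parity xs
sum-lookup []       = refl
sum-lookup (x ∷ xs) = cong (x xor_) (sum-lookup xs)

-- Parity is a sum in the commutative monoid of `Bool` under `_xor_`, and such sums do not depend on
-- the order of summation.
parity-permute : ∀ {k} (π : Permutation′ k) xs → parity (permute π xs) ≡ parity xs
parity-permute π xs = begin
  parity (permute π xs)              ≡⟨ parity-tabulate (λ i → lookup xs (π ⟨$⟩ʳ i)) ⟩
  sum (λ i → lookup xs (π ⟨$⟩ʳ i))   ≡⟨ sum-permute (lookup xs) π ⟨
  sum (lookup xs)                    ≡⟨ sum-lookup xs ⟩
  parity xs                          ∎
  where open ≡-Reasoning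

-- The variable set of an XOR clause.

∈-members : ∀ {n} {v : Fin n} (a : Subset n) → v ∈ᵥ members a ⇔ v Subset.∈ a
∈-members a = mk⇔ (fwd a) (bwd a)
  where
  fwd : ∀ {n} {v : Fin n} (a : Subset n) → v ∈ᵥ members a → v Subset.∈ a
  fwd (inside  ∷ a) (VecAny.here refl) = Vec.here
  fwd (inside  ∷ a) (VecAny.there p) with _ , q , refl ← find (VecAny.map⁻ p) = Vec.there (fwd a q)
  fwd (outside ∷ a) p with _ , q , refl ← find (VecAny.map⁻ p) = Vec.there (fwd a q)

  bwd : ∀ {n} {v : Fin n} (a : Subset n) → v Subset.∈ a → v ∈ᵥ members a
  bwd (inside  ∷ a) Vec.here      = VecAny.here refl
  bwd (inside  ∷ a) (Vec.there p) = VecAny.there (∈ᵥ.∈-map⁺ suc (bwd a p))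
  bwd (outside ∷ a) (Vec.there p) = ∈ᵥ.∈-map⁺ suc (bwd a p)

∈-subst : ∀ {A : Set} {j k} (e : j ≡ k) {x} (xs : Vec A j) → x ∈ᵥ subst (Vec A) e xs ⇔ x ∈ᵥ xs
∈-subst refl xs = mk⇔ (λ p → p) (λ p → p)

∈-variables : ∀ {n} {v : Fin n} (c@((a , _) , _) : XORClause n) → v ∈ᵥ variables c ⇔ v Subset.∈ a
∈-variables ((a , w) , _) = ∈-members a ⇔-∘ ∈-subst w (members a)

-- Decoding an XOR clause from a single 3-clause.

variables-excluding : ∀ {n} (vs : Vec (Fin n) 3) α → Vec.map proj₁ (excluding vs α) ≡ vs
variables-excluding (_ ∷ _ ∷ _ ∷ []) (_ ∷ _ ∷ _ ∷ []) = refl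

signs-excluding : ∀ {n} (vs : Vec (Fin n) 3) α →
  Vec.map proj₂ (excluding vs α) ≡ Vec.map not α
signs-excluding (_ ∷ _ ∷ _ ∷ []) (_ ∷ _ ∷ _ ∷ []) = refl

-- A violating assignment has parity `not b`, and negating three bits, an odd number, flips the
-- parity back to `b`.
violating-parity : ∀ b → VecAll.All (λ α → parity (Vec.map not α) ≡ b) (violating b)
violating-parity false = refl VecAll.∷ refl VecAll.∷ refl VecAll.∷ refl VecAll.∷ VecAll.[]
violating-parity true  = refl VecAll.∷ refl VecAll.∷ refl VecAll.∷ refl VecAll.∷ VecAll.[]

-- The variables enter only as a set and the signs only through their parity, so no reordering of
-- the literals can affect the relation.
Encodes : ∀ {n} → XORClause n → Clause n → Set
Encodes ((a , _) , b) C =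
  (∀ {v} → v ∈ᵥ Vec.map proj₁ C ⇔ v Subset.∈ a) × parity (Vec.map proj₂ C) ≡ b

encodes-unique : ∀ {n} (c d : XORClause n) C → Encodes c C → Encodes d C → c ≡ d
encodes-unique ((a , w) , b) ((a′ , w′) , b′) _ (va , refl) (va′ , refl)
  -- The two rows have the same members, so they agree as subsets; their weight proofs then agree
  -- because equality on `ℕ` is proof-irrelevant.
  with refl ← ⊆-antisym {i = a} {j = a′} (to va′ ∘ from va) (to va ∘ from va′)
  with refl ← ℕ.≡-irrelevant w w′ = refl

-- Injectivity of the block map and of the translation.

module _ {n : ℕ} (conv : Convention n) where
  open Convention conv

  block-encodes : ∀ c i → Encodes c (lookup (block conv c) i)
  block-encodes c@((a , _) , b) i = subst (Encodes c) (sym lookup-block) encodes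
    where
    clause : Vec Bool 3 → Clause n
    clause α = permute (literalOrder c α) (excluding (variables c) α)

    -- Position `i` of the block holds the clause that was at position `j` before reordering.
    j = clauseOrder c ⟨$⟩ʳ i
    α = lookup (violating b) j
    π = literalOrder c α
    C = excluding (variables c) α

    lookup-block : lookup (block conv c) i ≡ permute π C
    lookup-block = trans
      (lookup∘tabulate (λ i → lookup (Vec.map clause (violating b)) (clauseOrder c ⟨$⟩ʳ i)) i)
      (lookup-map j clause (violating b))

    variables≡ : Vec.map proj₁ (permute π C) ≡ permute π (variables c)
    variables≡ = trans (map-permute π proj₁ C)
      (cong (permute π) (variables-excluding (variables c) α))

    signs≡ : Vec.map proj₂ (permute π C) ≡ permute π (Vec.map not α)
    signs≡ = trans (map-permute π proj₂ C) (cong (permute π) (signs-excluding (variables c) α))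

    encodes : Encodes c (permute π C)
    encodes =
      (λ {v} → subst (λ vs → v ∈ᵥ vs ⇔ v Subset.∈ a) (sym variables≡)
        (∈-variables c ⇔-∘ ∈-permute π (variables c))) ,
      (begin
        parity (Vec.map proj₂ (permute π C))   ≡⟨ cong parity signs≡ ⟩
        parity (permute π (Vec.map not α))     ≡⟨ parity-permute π (Vec.map not α) ⟩
        parity (Vec.map not α)                 ≡⟨ VecAll.lookup⁺ (violating-parity b) j ⟩
        b                                      ∎)
      where open ≡-Reasoning

  -- One clause already determines the XOR clause, so comparing the blocks at any one position
  -- suffices; `zero` is an arbitrary choice.
  block-injective : Injective _≡_ _≡_ (block conv)
  block-injective {c} {d} e = encodes-unique c d (lookup (block conv c) zero)
    (block-encodes c zero)
    (subst (λ B → Encodes d (lookup B zero)) (sym e) (block-encodes d zero))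

  R-injective : ∀ m → Injective _≡_ _≡_ (R conv m)
  R-injective _ = go _ _
    where
    go : ∀ {m} (Φ Φ′ : XORInstance n m) → R conv m Φ ≡ R conv m Φ′ → Φ ≡ Φ′
    go []      []        _ = refl
    -- Both leading blocks have length four, so equal concatenations split into equal blocks and
    -- equal remainders.
    go (c ∷ Φ) (c′ ∷ Φ′) e with p , q ← ++-injective (block conv c) (block conv c′) e =
      cong₂ _∷_ (block-injective p) (go Φ Φ′ q)

-- Counting and summing over finite types.

unique∧set⇒length : ∀ {A : Set} {xs ys : List A} →
  Unique xs → Unique ys → xs ∼[ set ] ys → length xs ≡ length ys
-- Without repetitions, equal sets of elements are equal multisets, so the lists are permutations of
-- each other.
unique∧set⇒length u v s = ↭-length (∼bag⇒↭ (unique∧set⇒bag u v s))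

∈-satisfying : ∀ {A : Set} ⦃ _ : Finite A ⦄ {P : A → Set} (P? : Decidable P) {x : A} →
  x ∈ filter P? elements ⇔ P x
∈-satisfying P? = mk⇔ (proj₂ ∘ ∈-filter⁻ P? {xs = elements}) (∈-filter⁺ P? (complete _))

module _ {A : Set} ⦃ _ : Finite A ⦄ {P : A → Set} (P? : Decidable P) where

  card-singleton : ∀ {x} → P x → (∀ {y} → P y → y ≡ x) → card P? ≡ 1
  card-singleton {x} px only = unique∧set⇒length (Unique.filter⁺ P? unique) (All.[] ∷ [])
    (mk⇔ (here ∘ only) (λ { (here refl) → px }) ⇔-∘ ∈-satisfying P?)

  card-empty : (∀ {x} → ¬ P x) → card P? ≡ 0
  card-empty ¬p = cong length (filter-none P? (All.universal (λ _ → ¬p) elements))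

  -- Injectivity keeps the mapped list free of repetitions, so it can be compared, as a set, with
  -- the enumeration of `Q`.
  card-image : ∀ {B : Set} ⦃ _ : Finite B ⦄ {Q : B → Set} (Q? : Decidable Q) {f : A → B} →
    Injective _≡_ _≡_ f → (∀ {y} → Q y ⇔ ∃ λ x → P x × f x ≡ y) → card P? ≡ card Q?
  card-image Q? {f} f-inj image = trans (sym (length-map f (filter P? elements)))
    (unique∧set⇒length (Unique.map⁺ f-inj (Unique.filter⁺ P? unique)) (Unique.filter⁺ Q? unique)
      (mk⇔ fwd bwd))
    where
    fwd : ∀ {y} → y ∈ List.map f (filter P? elements) → y ∈ filter Q? elements
    fwd p with x , q , refl ← ∈-map⁻ f p =
      from (∈-satisfying Q?) (from image (x , to (∈-satisfying P?) q , refl))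

    bwd : ∀ {y} → y ∈ filter Q? elements → y ∈ List.map f (filter P? elements)
    bwd p with x , px , refl ← to image (to (∈-satisfying Q?) p) =
      ∈-map⁺ f (from (∈-satisfying P?) px)

  ∑-indicator : ∀ q → ∑ (λ x → if does (P? x) then q else 0ℚ) ≡ card P? ×ℚ q
  ∑-indicator q = go elements
    where
    go : ∀ xs → List.foldr _+_ 0ℚ (List.map (λ x → if does (P? x) then q else 0ℚ) xs)
              ≡ length (filter P? xs) ×ℚ q
    go []       = refl
    go (x ∷ xs) with P? x
    ... | yes _ = cong (λ s → q + s) (go xs)
    ... | no  _ = trans (ℚ.+-identityˡ _) (go xs)

∑-zero : ∀ {A : Set} ⦃ _ : Finite A ⦄ {f : A → ℚ} → (∀ x → f x ≡ 0ℚ) → ∑ f ≡ 0ℚ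
∑-zero {f = f} f≡0 = go elements
  where
  go : ∀ xs → List.foldr _+_ 0ℚ (List.map f xs) ≡ 0ℚ
  go []       = refl
  go (x ∷ xs) = cong₂ _+_ (f≡0 x) (go xs)

-- The proofs of nonzeroness are irrelevant, so reciprocals certified in different ways can be
-- identified.
1/-cong : ∀ {k l} .⦃ _ : NonZero k ⦄ .⦃ _ : NonZero l ⦄ → k ≡ l → + 1 / k ≡ + 1 / l
1/-cong refl = refl

δ-zero : ∀ {A : Set} ⦃ _ : Finite A ⦄ {μ ν : Mass A} → (∀ x → μ x ≡ ν x) → δ μ ν ≡ 0ℚ
δ-zero {μ = μ} {ν} μ≡ν = trans (cong (½ *_) (∑-zero ∣μ-ν∣≡0)) (ℚ.*-zeroʳ ½)
  where
  ∣μ-ν∣≡0 : ∀ x → ∣ μ x - ν x ∣ ≡ 0ℚ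
  ∣μ-ν∣≡0 x = cong ∣_∣ (trans (cong (_- ν x) (μ≡ν x)) (ℚ.+-inverseʳ (ν x)))

-- Push-forward of the uniform distribution along an injection.

module _ {A B : Set} ⦃ _ : Finite A ⦄ ⦃ _ : Finite B ⦄
  {f : A → B} (f-inj : Injective _≡_ _≡_ f) where

  card-fiber : ∀ y → (∃ λ x → f x ≡ y) → card (λ x → f x ≟ y) ≡ 1
  card-fiber y (x , refl) = card-singleton (λ x → f x ≟ y) refl f-inj

  module _ (image? : Decidable (λ y → ∃ λ x → f x ≡ y)) (x₀ : A) where

    card-domain : card {A} U? ≡ card image?
    card-domain = card-image U? image? f-inj
      (mk⇔ (λ (x , e) → x , tt , e) (λ (x , _ , e) → x , e))

    pushforward-uniform : ∀ y →
      pushforward f (uniformOn U? (x₀ , tt)) y ≡ uniformOn image? (f x₀ , x₀ , refl) y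
    pushforward-uniform y = go
      where
      domain≢0 = card-nonZero U? (x₀ , tt)
      image≢0  = card-nonZero image? (f x₀ , x₀ , refl)

      u v : ℚ
      u = (+ 1 / card {A} U?) ⦃ domain≢0 ⦄
      v = (+ 1 / card image?) ⦃ image≢0 ⦄

      -- `U?` holds everywhere, so the uniform mass on the domain computes to the constant `u`.
      go : ∑ (λ x → if does (f x ≟ y) then u else 0ℚ) ≡ (if does (image? y) then v else 0ℚ)
      go with image? y
      ... | yes y∈image = begin
        ∑ (λ x → if does (f x ≟ y) then u else 0ℚ)   ≡⟨ ∑-indicator (λ x → f x ≟ y) u ⟩
        card (λ x → f x ≟ y) ×ℚ u                    ≡⟨ cong (_×ℚ u) (card-fiber y y∈image) ⟩
        -- This is `1 ×ℚ u` unfolded: the only preimage of `y` carries mass `u`.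
        u + 0ℚ                                       ≡⟨ ℚ.+-identityʳ u ⟩
        u                                            ≡⟨ 1/-cong ⦃ domain≢0 ⦄ ⦃ image≢0 ⦄ card-domain ⟩
        v                                            ∎
        where open ≡-Reasoning
      -- Off the image the fiber is empty, and the zero-fold multiple of `u` is `0ℚ`.
      ... | no y∉image = trans (∑-indicator (λ x → f x ≟ y) u)
        (cong (_×ℚ u) (card-empty (λ x → f x ≟ y) (λ e → y∉image (_ , e))))

lemma3 :
  (γ : ℚ) → 0ℚ < γ → γ ≤ 1ℚ →
  (n m : ℕ) → + m / 1 ≡ (1ℚ + γ) * (+ n / 1) →
  (conv : Convention n) →
  Injective _≡_ _≡_ (R conv m)
  × (∀ Ψ → Window conv m Ψ → card (fiber? conv m Ψ) ≡ 1)
  × ((Φ₀ : XORInstance n m) →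
      let μ = pushforward (R conv m) (uniformOn U? (Φ₀ , tt))
          ν = uniformOn (window? conv m) (R conv m Φ₀ , Φ₀ , refl)
      in (∀ Ψ → μ Ψ ≡ ν Ψ) × δ μ ν ≡ 0ℚ)
lemma3 _ _ _ n m _ conv =
  -- `Fiber` and `Window` unfold to the equation `f x ≡ y` and its existential closure for
  -- `f = R conv m`, so the facts about injections apply directly.
  R-injective conv m , card-fiber (R-injective conv m) , λ Φ₀ →
    let μ≡ν = pushforward-uniform (R-injective conv m) (window? conv m) Φ₀
    in μ≡ν , δ-zero μ≡ν
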